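{- Let $G$ be a connected interval graph. Then $\mathrm{pc}_r(G,k)\in O(k^2r)$. That is, there exists an absolute constant $C>0$ such that for every connected interval graph $G$, every positive integer $r$ and every integer $k$ with $1\le k\le |V(G)|$, one has $\mathrm{pc}_r(G,k)\le C\, k^2 r$.
   Context: All graphs are finite, simple, loopless and undirected. $\mathrm{dist}(u,v)$ is the usual graph distance (number of edges of a shortest path, $+\infty$ if there is none). For an integer $r$, let $\mathrm{Cap}_r(\ell)=\ell$ if $\ell\le r$ and $\mathrm{Cap}_r(\ell)=+\infty$ otherwise. For $A\subseteq V(G)$ and $v\in V(G)$, the $r$-profile of $v$ with respect to $A$ is the function $p_r(v,A):A\to\mathbb N\cup\{+\infty\}$, $a\mapsto \mathrm{Cap}_r(\mathrm{dist}(a,v))$. Let $\mathrm{pc}_r(G,A)=\big|\{p_r(v,A): v\in V(G)\}\setminus\{a\mapsto+\infty\}\big|$ (the number of distinct $r$-profiles with respect to $A$, not counting the constant $+\infty$ profile), and let $\mathrm{pc}_r(G,k)=\max\{\mathrm{pc}_r(G,A): A\subseteq V(G), |A|=k\}$ (the $r$-profile complexity of $G$). An interval graph is the intersection graph of a finite family of intervals of the real line. -}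

module Defs where

open import Data.Fin.Base using (Fin)
open import Data.Fin.Properties as Fin using (any?; all?; injective⇒≤)
open import Data.Fin.Subset using (Subset; inside; outside; _∈_; ∣_∣)
open import Data.Fin.Subset.Properties using (_∈?_)
open import Data.List.Base as List
  using (List; []; _∷_; _++_; allFin; deduplicate; filter; length)
open import Data.List.Extrema.Nat using (max)
open import Data.List.Membership.Propositional using () renaming (_∈_ to _∈ˡ_)
open import Data.List.Membership.Propositional.Properties
  using (∈-map⁺; ∈-++⁺ˡ; ∈-++⁺ʳ)
open import Data.List.Relation.Unary.Any using (here)
open import Data.Nat.Base using (ℕ; zero; suc; _<_; _≤_; s≤s; s<s⁻¹; z≤n)
open import Data.Nat.Properties using (_≟_; _≤?_)
open import Data.Product.Base using (Σ; ∃; ∃-syntax; _×_; _,_; proj₁; proj₂)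
open import Data.Rational.Base as ℚ using (ℚ)
open import Data.Sum.Base using (_⊎_; inj₁; inj₂)
open import Data.Vec.Base as Vec using (Vec; []; _∷_)
open import Data.Vec.Properties.WithK using ([]=-irrelevant)
open import Data.Vec.Relation.Unary.AllPairs using (allPairs?)
open import Data.Vec.Relation.Unary.Linked using (Linked; linked?)
open import Data.Vec.Relation.Unary.Unique.Propositional using (Unique)
open import Data.Vec.Relation.Unary.Unique.Propositional.Properties
  using (lookup-injective)
open import Function.Base using (_∘_)
open import Function.Bundles using (_⇔_)
open import Level using (0ℓ)
open import Relation.Binary.Core using (Rel)
open import Relation.Binary.Definitions as B using (Irreflexive; Symmetric)
open import Relation.Binary.PropositionalEquality
  using (_≡_; _≢_; _≗_; refl; subst)
open import Relation.Nullary
  using (Dec; yes; no; ¬_; ¬?; contradiction; map′; _×-dec_)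
open import Relation.Nullary.Construct.Add.Supremum using (_⁺; [_]; ⊤⁺; ≡-dec)
open import Relation.Unary using (Pred; Satisfiable; _≬_)
import Relation.Unary as U

-- The real line: two-sided Dedekind cuts.

record ℝ : Set₁ where
  field
    L U         : Pred ℚ 0ℓ
    L-inhabited : Satisfiable L
    U-inhabited : Satisfiable U
    L-rounded   : ∀ p → L p ⇔ (∃[ q ] p ℚ.< q × L q)
    U-rounded   : ∀ q → U q ⇔ (∃[ p ] p ℚ.< q × U p)
    disjoint    : ∀ q → ¬ (L q × U q)
    located     : ∀ {p q} → p ℚ.< q → L p ⊎ U q

infix 4 _≤ʳ_

_≤ʳ_ : ℝ → ℝ → Set
x ≤ʳ y = ∀ {q} → ℝ.L x q → ℝ.L y q

-- Nonempty intervals of any kind: open, closed, half-open, bounded or not.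
-- Convexity forces the predicate to respect equality of reals (x ≤ y ≤ x).

record Interval : Set₁ where
  field
    points   : Pred ℝ 0ℓ
    nonempty : Satisfiable points
    convex   : ∀ {x y z} → x ≤ʳ y → y ≤ʳ z → points x → points z → points y

record Graph : Set₁ where
  infix 4 _~_ _~?_
  field
    order    : ℕ
    _~_      : Rel (Fin order) 0ℓ
    _~?_     : B.Decidable _~_
    ~-sym    : Symmetric _~_
    ~-irrefl : Irreflexive _≡_ _~_

  V : Set
  V = Fin order

IsIntervalGraph : Graph → Set₁
IsIntervalGraph G =
  Σ (V → Interval) λ I →
    ∀ u v → u ≢ v → (u ~ v) ⇔ (Interval.points (I u) ≬ Interval.points (I v))
  where open Graph G

ℕ∞ : Set
ℕ∞ = ℕ ⁺

pattern ∞ = ⊤⁺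

Cap : ℕ → ℕ∞ → ℕ∞
Cap r ∞     = ∞
Cap r [ l ] with l ≤? r
... | yes _ = [ l ]
... | no  _ = ∞

private
  anyVec? : ∀ {n k} {P : Pred (Vec (Fin n) k) 0ℓ} → U.Decidable P → Dec (∃ P)
  anyVec? {k = zero}  P? = map′ ([] ,_) (λ { ([] , p) → p }) (P? [])
  anyVec? {k = suc k} P? =
    map′ (λ (x , xs , p) → x ∷ xs , p) (λ { (x ∷ xs , p) → x , xs , p })
         (any? λ x → anyVec? λ xs → P? (x ∷ xs))

  least : ∀ {P : Pred ℕ 0ℓ} → U.Decidable P → ∀ n →
          (∃[ d ] P d × (∀ m → P m → d ≤ m)) ⊎ (∀ m → m < n → ¬ P m)
  least P? zero = inj₂ λ m ()
  least {P} P? (suc n) with P? 0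
  ... | yes p₀ = inj₁ (0 , p₀ , λ m _ → z≤n)
  ... | no ¬p₀ with least (P? ∘ suc) n
  ...   | inj₁ (d , p , min) = inj₁ (suc d , p , min′)
    where
    min′ : ∀ m → P m → suc d ≤ m
    min′ zero    q = contradiction q ¬p₀
    min′ (suc m) q = s≤s (min m q)
  ...   | inj₂ none = inj₂ none′
    where
    none′ : ∀ m → m < suc n → ¬ P m
    none′ zero    _   = ¬p₀
    none′ (suc m) m<n = none m (s<s⁻¹ m<n)

module _ (G : Graph) where
  open Graph G

  -- ℓ counts edges, so there are suc ℓ vertices.
  IsPath : V → V → ∀ {ℓ} → Vec V (suc ℓ) → Set
  IsPath u v p = Vec.head p ≡ u × Vec.last p ≡ v × Linked _~_ p × Unique p

  Path : V → V → ℕ → Set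
  Path u v ℓ = ∃[ p ] IsPath u v {ℓ} p

  Connected : Set
  Connected = ∀ u v → ∃ (Path u v)

  IsDistance : V → V → ℕ∞ → Set
  IsDistance u v [ d ] = Path u v d × (∀ ℓ → Path u v ℓ → d ≤ ℓ)
  IsDistance u v ∞     = ∀ ℓ → ¬ Path u v ℓ

  path? : ∀ u v → U.Decidable (Path u v)
  path? u v ℓ = anyVec? λ p →
    (Vec.head p Fin.≟ u) ×-dec (Vec.last p Fin.≟ v) ×-dec
    linked? _~?_ p ×-dec allPairs? (λ x y → ¬? (x Fin.≟ y)) p

  path-length< : ∀ {u v ℓ} → Path u v ℓ → ℓ < order
  path-length< (_ , _ , _ , _ , unique) =
    injective⇒≤ λ {i} {j} → lookup-injective unique i j

  distance : ∀ u v → ∃ (IsDistance u v)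
  distance u v with least (path? u v) order
  ... | inj₁ (d , p , min) = [ d ] , p , min
  ... | inj₂ none          = ∞ , λ ℓ p → none ℓ (path-length< p) p

  dist : V → V → ℕ∞
  dist u v = proj₁ (distance u v)

  Profile : Subset order → Set
  Profile A = (∃[ a ] a ∈ A) → ℕ∞

  profile : ℕ → (A : Subset order) → V → Profile A
  profile r A v (a , _) = Cap r (dist a v)

  ∞-profile : ∀ {A} → Profile A
  ∞-profile _ = ∞

  infix 4 _≗?_

  _≗?_ : ∀ {A} → B.Decidable {A = Profile A} _≗_
  _≗?_ {A} p q = map′ (λ f (a , a∈A) → f a a∈A) (λ f a a∈A → f (a , a∈A)) (all? at?)
    where
    at? : ∀ a → Dec (∀ (a∈A : a ∈ A) → p (a , a∈A) ≡ q (a , a∈A))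
    at? a with a ∈? A
    ... | no  a∉A = yes λ a∈A → contradiction a∈A a∉A
    ... | yes a∈A = map′
      (λ eq a∈A′ → subst (λ m → p (a , m) ≡ q (a , m)) ([]=-irrelevant a∈A a∈A′) eq)
      (λ f → f a∈A)
      (≡-dec _≟_ (p (a , a∈A)) (q (a , a∈A)))

  profiles : ℕ → (A : Subset order) → List (Profile A)
  profiles r A =
    filter (λ p → ¬? (p ≗? ∞-profile)) (deduplicate _≗?_ (List.map (profile r A) (allFin order)))

  pcOn : ℕ → Subset order → ℕ
  pcOn r A = length (profiles r A)

subsets : ∀ n → List (Subset n)
subsets zero    = [] ∷ []
subsets (suc n) = List.map (outside ∷_) (subsets n) ++ List.map (inside ∷_) (subsets n)

∈-subsets : ∀ {n} (A : Subset n) → A ∈ˡ subsets n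
∈-subsets []            = here refl
∈-subsets (outside ∷ A) = ∈-++⁺ˡ (∈-map⁺ (outside ∷_) (∈-subsets A))
∈-subsets (inside ∷ A)  =
  ∈-++⁺ʳ (List.map (outside ∷_) (subsets _)) (∈-map⁺ (inside ∷_) (∈-subsets A))

-- The default 0 is only returned when there is no A with |A| = k, i.e. k > |V|.
pc : ℕ → Graph → ℕ → ℕ
pc r G k = max 0 (List.map (pcOn G r) (filter (λ A → ∣ A ∣ ≟ k) (subsets (Graph.order G))))

-- The ball of radius i around a covers an interval [λᵢ, ρᵢ], and d(a, v) ≤ i + 1 iff v = [l, u]
-- meets it, i.e. iff λᵢ ≤ u and ρᵢ ≥ l. So, apart from the k vertices of A, the profile of v is
-- determined by the positions of l among the ρᵢ(a) and of u among the λᵢ(a), with a ∈ A and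
-- i < r. The position of l among all these 2kr cuts takes at most 2kr + 1 values. Given it, u has
-- only k + 1 possible positions among the λᵢ(a): if l < λᵢ(a) ≤ u, then v meets the ball of
-- radius i and hence λⱼ(a) ≤ l for all j > i, so each a contributes at most one cut in (l, u].
-- In total there are at most k + (2kr + 1)(k + 1) ≤ 7k²r profiles. The conclusion is decidable,
-- so the real intervals may be replaced by intervals of ℕ under a double negation.

module Submission where

open import Defs
open import Data.Empty using (⊥)
open import Data.Fin.Base as Fin using (Fin; zero; suc; fromℕ<; join; combine)
open import Data.Fin.Properties as Fin
  using (any?; injective⇒≤; sequence; splitAt-join; combine-injective; fromℕ<-injective)
open import Data.Fin.Subset using (Subset; inside; outside; _∈_; ∣_∣)
open import Data.Fin.Subset.Properties using (_∈?_)
open import Data.List.Base as List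
  using (List; []; _∷_; allFin; cartesianProduct; filter; length; map; upTo)
open import Data.List.Extrema.Nat
  using (argmin; argmax; argmin-all; argmax-all; f[argmin]≤f[⊤]; f[argmin]≤f[xs];
         f[⊥]≤f[argmax]; f[xs]≤f[argmax]; max≤v⁺)
open import Data.List.Membership.Propositional using () renaming (_∈_ to _∈ˡ_)
open import Data.List.Membership.Propositional.Properties
  using (∈-map⁺; ∈-allFin; ∈-cartesianProduct⁺; ∈-filter⁺; ∈-lookup; ∈-upTo⁺)
open import Data.List.Membership.Setoid.Properties using (index-injective)
open import Data.List.Properties using (length-map; length-upTo)
open import Data.List.Relation.Unary.All as All using (All; []; _∷_)
open import Data.List.Relation.Unary.All.Properties as All using (all-filter)
open import Data.List.Relation.Unary.AllPairs as AllPairs using (AllPairs; []; _∷_)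
open import Data.List.Relation.Unary.AllPairs.Properties as AllPairs using (applyUpTo⁺₁)
open import Data.List.Relation.Unary.Any using (here; there; index)
open import Data.List.Relation.Unary.Unique.DecSetoid.Properties using (deduplicate-!)
open import Data.Nat.Base using (ℕ; zero; suc; _+_; _∸_; _≤_; _<_; _*_; _^_; z≤n; s≤s)
open import Data.Nat.ListAction using (sum)
open import Data.Nat.Properties
open import Data.Nat.Solver using (module +-*-Solver)
open import Data.Product.Base using (∃-syntax; _×_; _,_; proj₁; proj₂; uncurry)
open import Data.Product.Properties using (,-injective)
import Data.Rational.Base as ℚ
import Data.Rational.Properties as ℚ
open import Data.Sum.Base as Sum using (_⊎_; inj₁; inj₂; [_,_]′)
open import Data.Sum.Properties using (inj₁-injective; inj₂-injective)
open import Data.Vec.Base as Vec using (Vec; []; _∷_)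
open import Data.Vec.Relation.Unary.All as Vecᵃ using ([]; _∷_)
open import Data.Vec.Relation.Unary.AllPairs using ([]; _∷_)
open import Data.Vec.Relation.Unary.Linked using ([-]; _∷_)
open import Effect.Monad using (RawMonad)
open import Function.Base using (_∘_)
open import Function.Bundles using (_⇔_; mk⇔; Equivalence)
open import Function.Definitions using (Injective)
open import Level using (0ℓ)
open import Relation.Binary.Bundles using (DecSetoid)
open import Relation.Binary.Core using (Rel; _Preserves_⟶_)
open import Relation.Binary.Definitions as B using (Symmetric; tri<; tri≈; tri>)
open import Relation.Binary.PropositionalEquality
  using (_≡_; _≢_; _≗_; refl; sym; trans; cong; cong₂; subst; setoid)
open import Relation.Nullary
  using (Dec; yes; no; ¬_; ¬?; contradiction; _×-dec_)
open import Relation.Nullary.Construct.Add.Supremum using ([_])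
open import Relation.Nullary.Decidable using (decidable-stable; ¬¬-excluded-middle)
open import Relation.Nullary.Negation using (¬¬-Monad; ¬¬-map)
open import Relation.Unary using (Pred; _≬_)
import Relation.Unary as U

open Equivalence using (to; from)
open +-*-Solver using (solve; _:+_; _:*_; _:=_; con)

-- Sums of monotone functions and counting.

Monotone : (ℕ → ℕ) → Set
Monotone f = f Preserves _≤_ ⟶ _≤_

+-tight : ∀ {a b c d} → a ≤ c → b ≤ d → c + d ≤ a + b → a ≡ c × b ≡ d
+-tight {a} {b} {c} {d} a≤c b≤d c+d≤a+b =
  ≤-antisym a≤c (+-cancelʳ-≤ d c a (≤-trans c+d≤a+b (+-monoʳ-≤ a b≤d))) ,
  ≤-antisym b≤d (+-cancelˡ-≤ c d b (≤-trans c+d≤a+b (+-monoˡ-≤ b a≤c)))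

module _ {I : Set} where

  Σ[_] : List I → (I → ℕ) → ℕ
  Σ[ is ] f = sum (map f is)

  Σ-mono : ∀ is {f g : I → ℕ} → (∀ {i} → i ∈ˡ is → f i ≤ g i) → Σ[ is ] f ≤ Σ[ is ] g
  Σ-mono []       f≤g = z≤n
  Σ-mono (i ∷ is) f≤g = +-mono-≤ (f≤g (here refl)) (Σ-mono is (f≤g ∘ there))

  Σ-≤ : ∀ is {f : I → ℕ} {c} → (∀ i → f i ≤ c) → Σ[ is ] f ≤ length is * c
  Σ-≤ []       f≤c = z≤n
  Σ-≤ (i ∷ is) f≤c = +-mono-≤ (f≤c i) (Σ-≤ is f≤c)

  Σ-≤-suc : ∀ is {f g : I → ℕ} → (∀ i → f i ≤ suc (g i)) → Σ[ is ] f ≤ length is + Σ[ is ] g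
  Σ-≤-suc []       f≤1+g = z≤n
  Σ-≤-suc (i ∷ is) {f} {g} f≤1+g = begin
    f i + Σ[ is ] f                      ≤⟨ +-mono-≤ (f≤1+g i) (Σ-≤-suc is f≤1+g) ⟩
    suc (g i) + (length is + Σ[ is ] g)  ≡⟨ cong suc (+-assoc (g i) _ _) ⟨
    suc (g i + length is + Σ[ is ] g)    ≡⟨ cong (λ m → suc (m + Σ[ is ] g)) (+-comm (g i) _) ⟩
    suc (length is + g i + Σ[ is ] g)    ≡⟨ cong suc (+-assoc (length is) _ _) ⟩
    suc (length is) + Σ[ i ∷ is ] g      ∎
    where open ≤-Reasoning

  Σ-tight : ∀ is {f g : I → ℕ} → (∀ i → f i ≤ g i) → Σ[ is ] g ≤ Σ[ is ] f →
            ∀ {i} → i ∈ˡ is → f i ≡ g i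
  Σ-tight (i ∷ is) f≤g Σg≤Σf i∈is
    with +-tight (f≤g i) (Σ-mono is λ {j} _ → f≤g j) Σg≤Σf | i∈is
  ... | fi≡gi , Σf≡Σg | here refl = fi≡gi
  ... | fi≡gi , Σf≡Σg | there i∈  = Σ-tight is f≤g (≤-reflexive (sym Σf≡Σg)) i∈

  Σ-monotone : ∀ is {f : I → ℕ → ℕ} → (∀ i → Monotone (f i)) → Monotone (λ x → Σ[ is ] λ i → f i x)
  Σ-monotone is mono x≤y = Σ-mono is λ {i} _ → mono i x≤y

  -- Between `x` and `y` all summands move in the same direction, so equal totals leave no room for
  -- any of them to change. A single number thus records the value of every summand.
  Σ-determines : ∀ is {f : I → ℕ → ℕ} → (∀ i → Monotone (f i)) → ∀ {x y} →
                 Σ[ is ] (λ i → f i x) ≡ Σ[ is ] (λ i → f i y) →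
                 ∀ {i} → i ∈ˡ is → f i x ≡ f i y
  Σ-determines is mono {x} {y} eq i∈ with ≤-total x y
  ... | inj₁ x≤y = Σ-tight is (λ i → mono i x≤y) (≤-reflexive (sym eq)) i∈
  ... | inj₂ y≤x = sym (Σ-tight is (λ i → mono i y≤x) (≤-reflexive eq) i∈)

+-determines : ∀ {f g : ℕ → ℕ} → Monotone f → Monotone g → ∀ {x y} →
               f x + g x ≡ f y + g y → f x ≡ f y × g x ≡ g y
+-determines f-mono g-mono {x} {y} eq with ≤-total x y
... | inj₁ x≤y = +-tight (f-mono x≤y) (g-mono x≤y) (≤-reflexive (sym eq))
... | inj₂ y≤x with p , q ← +-tight (f-mono y≤x) (g-mono y≤x) (≤-reflexive eq) =
  sym p , sym q

𝟙 : ∀ {P : Set} → Dec P → ℕ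
𝟙 (yes _) = 1
𝟙 (no  _) = 0

module _ {P Q : Set} where

  𝟙-mono : (P? : Dec P) (Q? : Dec Q) → (P → Q) → 𝟙 P? ≤ 𝟙 Q?
  𝟙-mono (no  _) Q?      P⇒Q = z≤n
  𝟙-mono (yes p) (yes _) P⇒Q = ≤-refl
  𝟙-mono (yes p) (no ¬q) P⇒Q = contradiction (P⇒Q p) ¬q

  𝟙-≡ : (P? : Dec P) (Q? : Dec Q) → 𝟙 P? ≡ 𝟙 Q? → P → Q
  𝟙-≡ (yes _) (yes q) eq p = q
  𝟙-≡ (no ¬p) Q?      eq p = contradiction p ¬p

𝟙≤1 : ∀ {P : Set} (P? : Dec P) → 𝟙 P? ≤ 1
𝟙≤1 (yes _) = ≤-refl
𝟙≤1 (no  _) = z≤n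

-- The `AllPairs` hypothesis allows at most one index in `P` but outside `Q`: after the first such
-- index, every later member of `P` is in `Q`. That index accounts for the `suc`.
count-≤-suc : ∀ {I : Set} {P Q : Pred I 0ℓ} (P? : U.Decidable P) (Q? : U.Decidable Q) →
              ∀ is → AllPairs (λ i j → P i → Q i ⊎ (P j → Q j)) is →
              Σ[ is ] (𝟙 ∘ P?) ≤ suc (Σ[ is ] (𝟙 ∘ Q?))
count-≤-suc P? Q? []       []           = z≤n
count-≤-suc {P = P} {Q} P? Q? (i ∷ is) (ok ∷ oks) with P? i | Q? i
... | no  _ | yes _ = ≤-trans (count-≤-suc P? Q? is oks) (n≤1+n _)
... | no  _ | no  _ = count-≤-suc P? Q? is oks
... | yes _ | yes _ = s≤s (count-≤-suc P? Q? is oks)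
... | yes p | no ¬q = s≤s (Σ-mono is λ {j} j∈ → 𝟙-mono (P? j) (Q? j) (P⇒Q j∈))
  where
  P⇒Q : ∀ {j} → j ∈ˡ is → P j → Q j
  P⇒Q j∈ pj with All.lookup ok j∈ p
  ... | inj₁ q = contradiction q ¬q
  ... | inj₂ f = f pj

AllPairs-lookup : ∀ {a r} {A : Set a} {R : Rel A r} → Symmetric R → ∀ {xs} → AllPairs R xs →
                  ∀ {i j} → i ≢ j → R (List.lookup xs i) (List.lookup xs j)
AllPairs-lookup R-sym (_  ∷ _)  {zero}  {zero}  i≢j = contradiction refl i≢j
AllPairs-lookup R-sym (Rx ∷ _)  {zero}  {suc j} i≢j = All.lookup Rx (∈-lookup j)
AllPairs-lookup R-sym (Rx ∷ _)  {suc i} {zero}  i≢j = R-sym (All.lookup Rx (∈-lookup i))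
AllPairs-lookup R-sym (_  ∷ Rs) {suc i} {suc j} i≢j = AllPairs-lookup R-sym Rs (i≢j ∘ cong suc)

-- Elements of a subset, and capped distances.

elements : ∀ {n} → Subset n → List (Fin n)
elements []            = []
elements (outside ∷ A) = map suc (elements A)
elements (inside  ∷ A) = zero ∷ map suc (elements A)

length-elements : ∀ {n} (A : Subset n) → length (elements A) ≡ ∣ A ∣
length-elements []            = refl
length-elements (outside ∷ A) = trans (length-map suc (elements A)) (length-elements A)
length-elements (inside  ∷ A) = cong suc (trans (length-map suc (elements A)) (length-elements A))

∈-elements : ∀ {n} {A : Subset n} {a} → a ∈ A → a ∈ˡ elements A
∈-elements {A = inside  ∷ A} Vec.here       = here refl
∈-elements {A = inside  ∷ A} (Vec.there a∈) = there (∈-map⁺ suc (∈-elements a∈))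
∈-elements {A = outside ∷ A} (Vec.there a∈) = ∈-map⁺ suc (∈-elements a∈)

infix 4 _≤∞_ _≤∞?_

_≤∞_ : ℕ∞ → ℕ → Set
[ d ] ≤∞ j = d ≤ j
∞     ≤∞ j = ⊥

_≤∞?_ : B.Decidable _≤∞_
[ d ] ≤∞? j = d ≤? j
∞     ≤∞? j = no λ ()

≤∞-trans : ∀ x {i j} → x ≤∞ i → i ≤ j → x ≤∞ j
≤∞-trans [ d ] d≤i i≤j = ≤-trans d≤i i≤j

-- A value at most `r` is the least threshold it satisfies, so testing each side at the other's
-- value gives both inequalities. A value above `r` satisfies no threshold up to `r` and is capped
-- to `∞`.
Cap-cong : ∀ r x y → (∀ {j} → j ≤ r → x ≤∞ j ⇔ y ≤∞ j) → Cap r x ≡ Cap r y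
Cap-cong r ∞     ∞     x⇔y = refl
Cap-cong r ∞     [ e ] x⇔y with e ≤? r
... | yes e≤r = contradiction (from (x⇔y e≤r) ≤-refl) λ ()
... | no  _   = refl
Cap-cong r [ d ] ∞     x⇔y with d ≤? r
... | yes d≤r = contradiction (to (x⇔y d≤r) ≤-refl) λ ()
... | no  _   = refl
Cap-cong r [ d ] [ e ] x⇔y with d ≤? r | e ≤? r
... | yes d≤r | yes e≤r = cong [_] (≤-antisym (from (x⇔y e≤r) ≤-refl) (to (x⇔y d≤r) ≤-refl))
... | yes d≤r | no  e≰r = contradiction (≤-trans (to (x⇔y d≤r) ≤-refl) d≤r) e≰r
... | no  d≰r | yes e≤r = contradiction (≤-trans (from (x⇔y e≤r) ≤-refl) e≤r) d≰r
... | no  _   | no  _   = refl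

-- Walks, paths and balls.

module Distance (G : Graph) where
  open Graph G

  -- Distances are defined by simple paths; walks may repeat vertices, so edges can be added at
  -- either end without a proof of uniqueness.
  data Walk : V → V → ℕ → Set where
    []  : ∀ {u} → Walk u u 0
    _∷_ : ∀ {u w v n} → u ~ w → Walk w v n → Walk u v (suc n)

  walk-snoc : ∀ {u w v n} → Walk u w n → w ~ v → Walk u v (suc n)
  walk-snoc []       w~v = w~v ∷ []
  walk-snoc (e ∷ es) w~v = e ∷ walk-snoc es w~v

  walk-unsnoc : ∀ {u v n} → Walk u v (suc n) → ∃[ w ] Walk u w n × w ~ v
  walk-unsnoc (e ∷ [])         = _ , [] , e
  walk-unsnoc (e ∷ es@(_ ∷ _)) with w , es′ , w~v ← walk-unsnoc es = w , e ∷ es′ , w~v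

  path⇒walk : ∀ {u v ℓ} → Path G u v ℓ → Walk u v ℓ
  path⇒walk (x ∷ []     , refl , refl , _         , _)        = []
  path⇒walk (x ∷ y ∷ ys , refl , last , x~y ∷ ys~ , (_ ∷ ys!)) =
    x~y ∷ path⇒walk (y ∷ ys , refl , last , ys~ , ys!)

  -- If `u` occurs on the path, the part from that occurrence onwards is a path from `u` that is no
  -- longer. This lets a walk become a path without growing.
  prepend-or-cut : ∀ u {w v ℓ} (p : Path G w v ℓ) →
                   Vecᵃ.All (u ≢_) (proj₁ p) ⊎ (∃[ m ] m ≤ ℓ × Path G u v m)
  prepend-or-cut u p@(x ∷ _ , _) with u Fin.≟ x
  prepend-or-cut u p@(_ , refl , p′) | yes refl = inj₂ (_ , ≤-refl , p)
  prepend-or-cut u (x ∷ [] , _) | no u≢x = inj₁ (u≢x ∷ [])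
  prepend-or-cut u (x ∷ y ∷ ys , _ , last , _ ∷ ys~ , (_ ∷ ys!)) | no u≢x
    with prepend-or-cut u (y ∷ ys , refl , last , ys~ , ys!)
  ... | inj₁ u∉ys          = inj₁ (u≢x ∷ u∉ys)
  ... | inj₂ (m , m≤ℓ , q) = inj₂ (m , m≤n⇒m≤1+n m≤ℓ , q)

  walk⇒path : ∀ {u v n} → Walk u v n → ∃[ m ] m ≤ n × Path G u v m
  walk⇒path {u} [] = 0 , z≤n , u ∷ [] , refl , refl , [-] , ([] ∷ [])
  walk⇒path {u} (u~w ∷ es) with walk⇒path es
  ... | m , m≤n , p with prepend-or-cut u p
  ...   | inj₂ (m′ , m′≤m , q) = m′ , m≤n⇒m≤1+n (≤-trans m′≤m m≤n) , q
  ...   | inj₁ u∉p with p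
  ...     | x ∷ xs , refl , last , xs~ , xs! =
    suc m , s≤s m≤n , u ∷ x ∷ xs , refl , last , u~w ∷ xs~ , (u∉p ∷ xs!)

  -- Stated through the computed `dist` rather than the existence of a walk, which makes membership
  -- decidable at once.
  Ball : V → ℕ → Pred V 0ℓ
  Ball a i v = dist G a v ≤∞ i

  Ball? : ∀ a i → U.Decidable (Ball a i)
  Ball? a i v = dist G a v ≤∞? i

  ball⇒walk : ∀ {a i v} → Ball a i v → ∃[ m ] m ≤ i × Walk a v m
  ball⇒walk {a} {i} {v} d≤i with distance G a v
  ... | [ d ] , p , _ = d , d≤i , path⇒walk p

  walk⇒ball : ∀ {a v n} → Walk a v n → Ball a n v
  walk⇒ball {a} {v} es with walk⇒path es | distance G a v
  ... | m , m≤n , p | [ d ] , _ , min  = ≤-trans (min m p) m≤n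
  ... | m , m≤n , p | ∞     , no-path = contradiction p (no-path m)

  ball-mono : ∀ {a i j v} → i ≤ j → Ball a i v → Ball a j v
  ball-mono {a} {v = v} i≤j v∈ = ≤∞-trans (dist G a v) v∈ i≤j

  ball-centre : ∀ {a i} → Ball a i a
  ball-centre {a} = ball-mono {a} {v = a} z≤n (walk⇒ball [])

  ball-zero : ∀ {a v} → Ball a 0 v → a ≡ v
  ball-zero v∈ with _ , z≤n , [] ← ball⇒walk v∈ = refl

  ball-step : ∀ {a i w v} → Ball a i w → w ~ v → Ball a (suc i) v
  ball-step {a} {v = v} w∈ w~v with m , m≤i , es ← ball⇒walk w∈ =
    ball-mono {a} {v = v} (s≤s m≤i) (walk⇒ball (walk-snoc es w~v))

  ball-unstep : ∀ {a i v} → Ball a (suc i) v → Ball a i v ⊎ (∃[ w ] Ball a i w × w ~ v)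
  ball-unstep {a} {v = v} v∈ with ball⇒walk v∈
  -- A walk of length 0 has no last edge to split off, but its end lies in every ball around `a`.
  ... | zero  , _       , es = inj₁ (ball-mono {a} {v = v} z≤n (walk⇒ball es))
  ... | suc m , s≤s m≤i , es with w , es′ , w~v ← walk-unsnoc es =
    inj₂ (w , ball-mono {a} {v = w} m≤i (walk⇒ball es′) , w~v)

-- Intervals with natural endpoints, and hulls of balls.

record IntervalModel (G : Graph) : Set where
  open Graph G
  field
    left right : V → ℕ
    left≤right : ∀ v → left v ≤ right v

  infix 4 _meets_

  _meets_ : Rel V 0ℓ
  u meets v = left u ≤ right v × left v ≤ right u

  field
    adjacent : ∀ u v → u ≢ v → u ~ v ⇔ u meets v

module Counting {G : Graph} (M : IntervalModel G) where
  open Graph G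
  open IntervalModel M
  open Distance G

  ~⇒meets : ∀ {u v} → u ~ v → u meets v
  ~⇒meets u~v = to (adjacent _ _ λ u≡v → ~-irrefl u≡v u~v) u~v

  ball-meets : ∀ {a i w v} → Ball a i w → w meets v → Ball a (suc i) v
  ball-meets {a} {i} {w} {v} w∈ w∩v with w Fin.≟ v
  -- `adjacent` speaks only of distinct vertices, while an interval always meets itself.
  ... | yes refl = ball-mono {a} {v = v} (n≤1+n i) w∈
  ... | no  w≢v  = ball-step {a} {w = w} w∈ (from (adjacent w v w≢v) w∩v)

  MeetsBall : V → ℕ → Pred V 0ℓ
  MeetsBall a i v = ∃[ w ] Ball a i w × w meets v

  meetsBall-suc : ∀ {a i v} → MeetsBall a i v → MeetsBall a (suc i) v
  meetsBall-suc {a} (w , w∈ , w∩v) = w , ball-mono {a} {v = w} (n≤1+n _) w∈ , w∩v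

  -- On the way from a to w, the first interval reaching v meets v.
  meets-rightwards : ∀ {a v} i {w} → right a < left v → Ball a i w → left v ≤ right w → MeetsBall a i v
  meets-rightwards {a} {v} zero {w} a<v w∈ v≤w with refl ← ball-zero {a} {w} w∈ =
    contradiction v≤w (<⇒≱ a<v)
  meets-rightwards {a} {v} (suc i) {w} a<v w∈ v≤w with ball-unstep {a} {i} {w} w∈
  ... | inj₁ w∈′ = meetsBall-suc (meets-rightwards i a<v w∈′ v≤w)
  ... | inj₂ (u , u∈ , u~w) with left v ≤? right u
  ...   | yes v≤u = meetsBall-suc (meets-rightwards i a<v u∈ v≤u)
  ...   | no  v≰u = w , w∈ , ≤-trans (proj₂ (~⇒meets u~w)) (≤-trans (≰⇒≥ v≰u) (left≤right v)) , v≤w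

  meets-leftwards : ∀ {a v} i {w} → right v < left a → Ball a i w → left w ≤ right v → MeetsBall a i v
  meets-leftwards {a} {v} zero {w} v<a w∈ w≤v with refl ← ball-zero {a} {w} w∈ =
    contradiction w≤v (<⇒≱ v<a)
  meets-leftwards {a} {v} (suc i) {w} v<a w∈ w≤v with ball-unstep {a} {i} {w} w∈
  ... | inj₁ w∈′ = meetsBall-suc (meets-leftwards i v<a w∈′ w≤v)
  ... | inj₂ (u , u∈ , u~w) with left u ≤? right v
  ...   | yes u≤v = meetsBall-suc (meets-leftwards i v<a u∈ u≤v)
  ...   | no  u≰v = w , w∈ , w≤v , ≤-trans (left≤right v) (≤-trans (≰⇒≥ u≰v) (proj₁ (~⇒meets u~w)))

  -- StartsBy a i x says λ ≤ x and EndsBefore a i x says ρ < x,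
  -- where [λ, ρ] is the hull of the ball of radius i around a.
  StartsBy EndsBefore : V → ℕ → Pred ℕ 0ℓ
  StartsBy   a i x = ∃[ w ] Ball a i w × left w ≤ x
  EndsBefore a i x = ¬ (∃[ w ] Ball a i w × x ≤ right w)

  reaches? : ∀ a i x → Dec (∃[ w ] Ball a i w × x ≤ right w)
  reaches? a i x = any? λ w → Ball? a i w ×-dec (x ≤? right w)

  startsBy? : ∀ a i → U.Decidable (StartsBy a i)
  startsBy? a i x = any? λ w → Ball? a i w ×-dec (left w ≤? x)

  endsBefore? : ∀ a i → U.Decidable (EndsBefore a i)
  endsBefore? a i x = ¬? (reaches? a i x)

  -- A ball is connected, so its hull has no gaps. Either `v` meets `a`, or it lies strictly to one
  -- side of `a`; then a walk from `a` to a member that reaches the near end of `v` has a vertex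
  -- meeting `v`.
  hull⇒ball : ∀ {a i v} → StartsBy a i (right v) → ¬ EndsBefore a i (left v) → Ball a (suc i) v
  hull⇒ball {a} {i} {v} (w , w∈ , w≤v) ¬before with decidable-stable (reaches? a i (left v)) ¬before
  ... | w′ , w′∈ , v≤w′ with left v ≤? right a | left a ≤? right v
  ... | yes v≤a | yes a≤v = ball-meets {a} {w = a} (ball-centre {a}) (a≤v , v≤a)
  ... | no  v≰a | _       with u , u∈ , u∩v ← meets-rightwards i (≰⇒> v≰a) w′∈ v≤w′ =
    ball-meets {a} {w = u} u∈ u∩v
  ... | _       | no  a≰v with u , u∈ , u∩v ← meets-leftwards i (≰⇒> a≰v) w∈ w≤v =
    ball-meets {a} {w = u} u∈ u∩v

  ball⇒hull : ∀ {a i v} → Ball a (suc i) v → StartsBy a i (right v) × ¬ EndsBefore a i (left v)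
  ball⇒hull {a} {i} {v} v∈ with ball-unstep {a} {i} {v} v∈
  ... | inj₁ v∈′ = (v , v∈′ , left≤right v) , λ before → before (v , v∈′ , left≤right v)
  ... | inj₂ (w , w∈ , w~v) with w≤v , v≤w ← ~⇒meets w~v =
    (w , w∈ , w≤v) , λ before → before (w , w∈ , v≤w)

  -- Cut counts and codes of vertices.

  module _ (r : ℕ) (A : Subset order) where

    starts ends : V → ℕ → ℕ
    starts a x = Σ[ upTo r ] λ i → 𝟙 (startsBy? a i x)
    ends   a x = Σ[ upTo r ] λ i → 𝟙 (endsBefore? a i x)

    startsᴬ endsᴬ : ℕ → ℕ
    startsᴬ x = Σ[ elements A ] λ a → starts a x
    endsᴬ   x = Σ[ elements A ] λ a → ends a x

    𝟙-starts-mono : ∀ a i → Monotone λ x → 𝟙 (startsBy? a i x)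
    𝟙-starts-mono a i {x} {y} x≤y = 𝟙-mono (startsBy? a i x) (startsBy? a i y)
      λ (w , w∈ , w≤x) → w , w∈ , ≤-trans w≤x x≤y

    𝟙-ends-mono : ∀ a i → Monotone λ x → 𝟙 (endsBefore? a i x)
    𝟙-ends-mono a i {x} {y} x≤y = 𝟙-mono (endsBefore? a i x) (endsBefore? a i y)
      λ before (w , w∈ , y≤w) → before (w , w∈ , ≤-trans x≤y y≤w)

    starts-mono : ∀ a → Monotone (starts a)
    starts-mono a = Σ-monotone (upTo r) (𝟙-starts-mono a)

    ends-mono : ∀ a → Monotone (ends a)
    ends-mono a = Σ-monotone (upTo r) (𝟙-ends-mono a)

    startsᴬ-mono : Monotone startsᴬ
    startsᴬ-mono = Σ-monotone (elements A) starts-mono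

    endsᴬ-mono : Monotone endsᴬ
    endsᴬ-mono = Σ-monotone (elements A) ends-mono

    startsᴬ-determines : ∀ {x y} → startsᴬ x ≡ startsᴬ y →
                         ∀ {a i} → a ∈ A → i < r → StartsBy a i x → StartsBy a i y
    startsᴬ-determines {x} {y} eq {a} {i} a∈A i<r = 𝟙-≡ (startsBy? a i x) (startsBy? a i y)
      -- The outer total fixes the count of each centre, and that count fixes the indicator of each
      -- radius.
      (Σ-determines (upTo r) (𝟙-starts-mono a)
        (Σ-determines (elements A) starts-mono eq (∈-elements a∈A)) (∈-upTo⁺ i<r))

    endsᴬ-determines : ∀ {x y} → endsᴬ x ≡ endsᴬ y →
                       ∀ {a i} → a ∈ A → i < r → EndsBefore a i x → EndsBefore a i y
    endsᴬ-determines {x} {y} eq {a} {i} a∈A i<r = 𝟙-≡ (endsBefore? a i x) (endsBefore? a i y)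
      (Σ-determines (upTo r) (𝟙-ends-mono a)
        (Σ-determines (elements A) ends-mono eq (∈-elements a∈A)) (∈-upTo⁺ i<r))

    -- If λᵢ lies in (left v, right v], then v meets the ball of radius i, so λⱼ ≤ left v for j > i.
    starts-right : ∀ a v → starts a (right v) ≤ suc (starts a (left v))
    starts-right a v = count-≤-suc (λ i → startsBy? a i (right v)) (λ i → startsBy? a i (left v))
      (upTo r) (applyUpTo⁺₁ _ r λ i<j _ → single i<j)
      where
      single : ∀ {i j} → i < j → StartsBy a i (right v) →
               StartsBy a i (left v) ⊎ (StartsBy a j (right v) → StartsBy a j (left v))
      single {i} {j} i<j (w , w∈ , w≤v) with left w ≤? left v
      ... | yes w≤ = inj₁ (w , w∈ , w≤)
      ... | no  w≰ = inj₂ λ _ → v , ball-mono {a} {v = v} i<j v∈ , ≤-refl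
        where
        v∈ : Ball a (suc i) v
        v∈ = ball-meets {a} {w = w} w∈ (w≤v , ≤-trans (≰⇒≥ w≰) (left≤right w))

    -- The number of pairs of `a ∈ A` and `i < r` whose cut `λᵢ(a)` lies in `(left v, right v]`. As
    -- `startsᴬ` is monotone, the truncated subtraction loses nothing.
    offset : V → ℕ
    offset v = startsᴬ (right v) ∸ startsᴬ (left v)

    offset≤ : ∀ v → offset v ≤ ∣ A ∣
    offset≤ v = begin
      startsᴬ (right v) ∸ startsᴬ (left v)
        ≤⟨ ∸-monoˡ-≤ (startsᴬ (left v)) (Σ-≤-suc (elements A) λ a → starts-right a v) ⟩
      length (elements A) + startsᴬ (left v) ∸ startsᴬ (left v)
        ≡⟨ m+n∸n≡m (length (elements A)) (startsᴬ (left v)) ⟩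
      length (elements A)
        ≡⟨ length-elements A ⟩
      ∣ A ∣ ∎
      where open ≤-Reasoning

    -- `EndsBefore` is phrased negatively so that both counts grow with their argument;
    -- `+-determines` then recovers each of them from the sum.
    position : V → ℕ
    position v = startsᴬ (left v) + endsᴬ (left v)

    Σ²-𝟙≤ : ∀ {P : V → Pred ℕ 0ℓ} (P? : ∀ a → U.Decidable (P a)) →
            Σ[ elements A ] (λ a → Σ[ upTo r ] (𝟙 ∘ P? a)) ≤ ∣ A ∣ * r
    Σ²-𝟙≤ P? = begin
      Σ[ elements A ] (λ a → Σ[ upTo r ] (𝟙 ∘ P? a)) ≤⟨ Σ-≤ (elements A) inner ⟩
      length (elements A) * r                        ≡⟨ cong (_* r) (length-elements A) ⟩
      ∣ A ∣ * r                                      ∎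
      where
      open ≤-Reasoning
      inner : ∀ a → Σ[ upTo r ] (𝟙 ∘ P? a) ≤ r
      inner a = ≤-trans (Σ-≤ (upTo r) (λ i → 𝟙≤1 (P? a i)))
                        (≤-reflexive (trans (*-identityʳ _) (length-upTo r)))

    position≤ : ∀ v → position v ≤ ∣ A ∣ * r + ∣ A ∣ * r
    position≤ v = +-mono-≤ (Σ²-𝟙≤ λ a i → startsBy? a i (left v))
                           (Σ²-𝟙≤ λ a i → endsBefore? a i (left v))

    position-offset-determine : ∀ {u v} → position u ≡ position v → offset u ≡ offset v →
                                startsᴬ (right u) ≡ startsᴬ (right v) × endsᴬ (left u) ≡ endsᴬ (left v)
    position-offset-determine {u} {v} pos off =
      trans (sym (offset+ u)) (trans (cong₂ _+_ off (proj₁ left≡)) (offset+ v)) , proj₂ left≡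
      where
      left≡ : startsᴬ (left u) ≡ startsᴬ (left v) × endsᴬ (left u) ≡ endsᴬ (left v)
      left≡ = +-determines {startsᴬ} {endsᴬ} startsᴬ-mono endsᴬ-mono {left u} {left v} pos
      offset+ : ∀ w → offset w + startsᴬ (left w) ≡ startsᴬ (right w)
      offset+ w = m∸n+n≡m (startsᴬ-mono (left≤right w))

    ball-transfer : ∀ {u v} → position u ≡ position v → offset u ≡ offset v →
                    ∀ {a i} → a ∈ A → i < r → Ball a (suc i) u → Ball a (suc i) v
    ball-transfer {u} {v} pos off {a} {i} a∈A i<r u∈ =
      let s≡s    , e≡e   = position-offset-determine {u} {v} pos off
          starts , ¬ends = ball⇒hull {a} {i} {u} u∈
      in hull⇒ball {a} {i} {v} (startsᴬ-determines s≡s a∈A i<r starts)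
                   -- The right end of the hull enters under a negation, so its comparison is
                   -- carried from `v` back to `u`.
                   (¬ends ∘ endsᴬ-determines (sym e≡e) a∈A i<r)

    -- With `k = ∣ A ∣`, positions range from 0 to `2kr` and offsets from 0 to `k`; hence the
    -- successors.
    positions offsets : ℕ
    positions = suc (∣ A ∣ * r + ∣ A ∣ * r)
    offsets   = suc ∣ A ∣

    -- Hulls control only balls of positive radius. Members of `A`, which balls of radius 0 can tell
    -- apart, are therefore coded individually.
    Code : Set
    Code = Fin (length (elements A)) ⊎ (Fin positions × Fin offsets)

    codeOf : ∀ {v} → Dec (v ∈ A) → Code
    codeOf     (yes v∈A) = inj₁ (index (∈-elements v∈A))
    codeOf {v} (no  _)   = inj₂ (fromℕ< (s≤s (position≤ v)) , fromℕ< (s≤s (offset≤ v)))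

    encode : Code → Fin (length (elements A) + positions * offsets)
    encode = join (length (elements A)) (positions * offsets) ∘ Sum.map₂ (uncurry combine)

    encode-injective : ∀ c d → encode c ≡ encode d → c ≡ d
    encode-injective c d eq = map₂-injective c d
      (trans (sym (splitAt-join (length (elements A)) (positions * offsets) _))
        (trans (cong (Fin.splitAt (length (elements A))) eq)
          (splitAt-join (length (elements A)) (positions * offsets) _)))
      where
      map₂-injective : ∀ c d → Sum.map₂ (uncurry combine) c ≡ Sum.map₂ (uncurry combine) d → c ≡ d
      map₂-injective (inj₁ _)        (inj₁ _)        refl = refl
      map₂-injective (inj₂ (m , m′)) (inj₂ (n , n′)) eq
        with refl , refl ← combine-injective m m′ n n′ (inj₂-injective eq) = refl

    code : V → Code
    code v = codeOf (v ∈? A)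

    codeOf-determines : ∀ {u v} (u∈? : Dec (u ∈ A)) (v∈? : Dec (v ∈ A)) →
                        codeOf u∈? ≡ codeOf v∈? → profile G r A u ≗ profile G r A v
    codeOf-determines (yes u∈A) (yes v∈A) eq (a , a∈A) =
      cong (λ w → Cap r (dist G a w))
        (index-injective (setoid V) (∈-elements u∈A) (∈-elements v∈A) (inj₁-injective eq))
    codeOf-determines {u} {v} (no u∉A) (no v∉A) eq (a , a∈A) =
      Cap-cong r (dist G a u) (dist G a v) same
      where
      pos≡ : position u ≡ position v
      pos≡ = fromℕ<-injective _ _ _ _ (proj₁ (,-injective (inj₂-injective eq)))
      off≡ : offset u ≡ offset v
      off≡ = fromℕ<-injective _ _ _ _ (proj₂ (,-injective (inj₂-injective eq)))
      same : ∀ {j} → j ≤ r → Ball a j u ⇔ Ball a j v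
      -- Both sides are false: a ball of radius 0 contains only its centre, which is in `A`, whereas
      -- `u` and `v` are not.
      same {zero}  _   = mk⇔
        (λ u∈ → contradiction (subst (_∈ A) (ball-zero {a} {u} u∈) a∈A) u∉A)
        (λ v∈ → contradiction (subst (_∈ A) (ball-zero {a} {v} v∈) a∈A) v∉A)
      same {suc i} i<r = mk⇔ (ball-transfer {u} {v} pos≡ off≡ a∈A i<r)
                             (ball-transfer {v} {u} (sym pos≡) (sym off≡) a∈A i<r)

    -- Pigeonhole: choose a vertex realising each listed profile. Equal codes force equal profiles
    -- and the listed profiles are pairwise different, so the chosen vertices have distinct codes.
    pcOn≤ : pcOn G r A ≤ ∣ A ∣ + positions * offsets
    pcOn≤ = subst (λ m → pcOn G r A ≤ m + positions * offsets)
                  (length-elements A) (injective⇒≤ {f = f} f-injective)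
      where
      xs : List (Profile G A)
      xs = profiles G r A

      -- Filtering and deduplication only drop entries, so each survivor is propositionally equal to
      -- some `profile G r A v`, although profiles are compared pointwise.
      realised : All (λ p → ∃[ v ] p ≡ profile G r A v) xs
      realised = All.filter⁺ (λ p → ¬? (_≗?_ G p (∞-profile G)))
        (All.deduplicate⁺ (_≗?_ G)
          (All.map⁺ {xs = allFin order} (All.tabulate λ {v} _ → v , refl)))

      distinct : AllPairs (λ p q → ¬ p ≗ q) xs
      distinct = AllPairs.filter⁺ (λ p → ¬? (_≗?_ G p (∞-profile G)))
        (deduplicate-! decSetoid (map (profile G r A) (allFin order)))
        where
        decSetoid : DecSetoid _ _
        decSetoid = record
          { isDecEquivalence = record
            { isEquivalence = record
              { refl  = λ _ → refl
              ; sym   = λ p≗q a → sym (p≗q a)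
              ; trans = λ p≗q q≗s a → trans (p≗q a) (q≗s a)
              }
            ; _≟_ = _≗?_ G {A} } }

      vertex : Fin (length xs) → V
      vertex i = proj₁ (All.lookup realised (∈-lookup i))

      vertex-profile : ∀ i → List.lookup xs i ≡ profile G r A (vertex i)
      vertex-profile i = proj₂ (All.lookup realised (∈-lookup i))

      f : Fin (length xs) → Fin (length (elements A) + positions * offsets)
      f i = encode (code (vertex i))

      f-injective : Injective _≡_ _≡_ f
      f-injective {i} {j} eq = decidable-stable (i Fin.≟ j) λ i≢j →
        AllPairs-lookup (λ p≉q q≗p → p≉q λ a → sym (q≗p a)) distinct i≢j λ a →
          trans (cong (λ p → p a) (vertex-profile i))
            (trans (codeOf-determines {vertex i} {vertex j} (vertex i ∈? A) (vertex j ∈? A)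
                     (encode-injective (code (vertex i)) (code (vertex j)) eq) a)
              (cong (λ p → p a) (sym (vertex-profile j))))

  pc≤ : ∀ r → 1 ≤ r → ∀ k → 1 ≤ k → pc r G k ≤ 7 * k ^ 2 * r
  -- `z≤n` bounds the default value 0 of `max`.
  pc≤ r 1≤r k 1≤k = max≤v⁺ z≤n
    (All.map⁺ (All.map bound≤ (all-filter _ (subsets order))))
    where
    open ≤-Reasoning
    bound≤ : ∀ {A} → ∣ A ∣ ≡ k → pcOn G r A ≤ 7 * k ^ 2 * r
    bound≤ {A} refl = begin
      pcOn G r A
        ≤⟨ pcOn≤ r A ⟩
      k + suc (k * r + k * r) * suc k
        -- As `k` and `r` are positive, `k ≤ k²r`, `1 + 2kr ≤ 3kr` and `k + 1 ≤ 2k`. The total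
        -- `k²r + 6k²r` is the source of the constant 7.
        ≤⟨ +-mono-≤ k≤ (*-mono-≤ (+-monoˡ-≤ (k * r + k * r) 1≤kr) (+-monoˡ-≤ k 1≤k)) ⟩
      k * (k * r) + (k * r + (k * r + k * r)) * (k + k)
        ≡⟨ solve 2 (λ k r →
             k :* (k :* r) :+ (k :* r :+ (k :* r :+ k :* r)) :* (k :+ k) :=
             con 7 :* (k :* (k :* con 1)) :* r) refl k r ⟩
      7 * k ^ 2 * r ∎
      where
      1≤kr : 1 ≤ k * r
      1≤kr = *-mono-≤ 1≤k 1≤r
      k≤ : k ≤ k * (k * r)
      k≤ = ≤-trans (≤-reflexive (sym (*-identityʳ k))) (*-monoʳ-≤ k 1≤kr)

-- From real intervals to natural endpoints.

≤ʳ-¬¬total : ∀ x y → ¬ ¬ (x ≤ʳ y ⊎ y ≤ʳ x)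
≤ʳ-¬¬total x y neither = neither (inj₂ y≤x)
  where
  module X = ℝ x
  module Y = ℝ y

  -- `q` separates `x` from `y`: a rational in the lower cut of `x` cannot reach `q`, since it would
  -- then be in the upper cut of `x` too.
  below : ∀ {q} → Y.L q → X.U q → x ≤ʳ y
  below {q} q∈L q∈U {s} s∈L with ℚ.<-cmp s q
  ... | tri< s<q _    _   = from (Y.L-rounded s) (q , s<q , q∈L)
  ... | tri≈ _   refl _   = contradiction (s∈L , q∈U) (X.disjoint s)
  ... | tri> _   _    q<s = contradiction (s∈L , from (X.U-rounded s) (q , q<s , q∈U)) (X.disjoint s)

  y≤x : y ≤ʳ x
  -- Roundedness makes room for locatedness: either `p` is below `x`, or `q` separates `x` from `y`,
  -- which `neither` excludes.
  y≤x {p} p∈ with q , p<q , q∈ ← to (Y.L-rounded p) p∈ with X.located p<q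
  ... | inj₁ p∈X = p∈X
  ... | inj₂ q∈U = contradiction (inj₁ λ {s} → below q∈ q∈U {s}) neither

≤ʳ-trans : ∀ x y z → x ≤ʳ y → y ≤ʳ z → x ≤ʳ z
≤ʳ-trans x y z x≤y y≤z q∈ = y≤z (x≤y q∈)

IsRepresentation : (G : Graph) → (Graph.V G → Interval) → Set₁
IsRepresentation G I =
  ∀ u v → u ≢ v → (u ~ v) ⇔ (Interval.points (I u) ≬ Interval.points (I v))
  where open Graph G

module Model (G : Graph) (I : Graph.V G → Interval) (intersection : IsRepresentation G I) where
  open Graph G

  infix 4 _∈ᴵ_

  _∈ᴵ_ : ℝ → V → Set
  x ∈ᴵ u = Interval.points (I u) x

  -- (u , v) names a common point of I u and I v if u ~ v, and some point of I u otherwise.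
  Point : Set
  Point = V × V

  common : ∀ {u v} → u ~ v → ∃[ x ] x ∈ᴵ u × x ∈ᴵ v
  common {u} {v} u~v = to (intersection u v λ u≡v → ~-irrefl u≡v u~v) u~v

  pt : Point → ℝ
  pt (u , v) with u ~? v
  ... | yes u~v = proj₁ (common u~v)
  ... | no  _   = proj₁ (Interval.nonempty (I u))

  pt∈₁ : ∀ u v → pt (u , v) ∈ᴵ u
  pt∈₁ u v with u ~? v
  ... | yes u~v = proj₁ (proj₂ (common u~v))
  ... | no  _   = proj₂ (Interval.nonempty (I u))

  pt∈₂ : ∀ {u v} → u ~ v → pt (u , v) ∈ᴵ v
  pt∈₂ {u} {v} u~v with u ~? v
  ... | yes u~v′ = proj₂ (proj₂ (common u~v′))
  ... | no  u≁v  = contradiction u~v u≁v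

  Comparison : Rel ℝ 0ℓ
  Comparison x y = Dec (x ≤ʳ y) × (x ≤ʳ y ⊎ y ≤ʳ x)

  ¬¬-comparison : ∀ x y → ¬ ¬ Comparison x y
  ¬¬-comparison x y ¬c = ≤ʳ-¬¬total x y λ t → ¬¬-excluded-middle λ d → ¬c (d , t)

  -- Double negation commutes with universal quantification over a finite type, here four times in a
  -- row.
  ¬¬-compare : ¬ ¬ (∀ u v u′ v′ → Comparison (pt (u , v)) (pt (u′ , v′)))
  ¬¬-compare = seq λ u → seq λ v → seq λ u′ → seq λ v′ → ¬¬-comparison (pt (u , v)) (pt (u′ , v′))
    where
    seq : ∀ {P : Pred V 0ℓ} → (∀ i → ¬ ¬ P i) → ¬ ¬ (∀ i → P i)
    seq = sequence (RawMonad.rawApplicative ¬¬-Monad)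

  module _ (compare : ∀ u v u′ v′ → Comparison (pt (u , v)) (pt (u′ , v′))) where

    _≤?ᴾ_ : ∀ i j → Dec (pt i ≤ʳ pt j)
    (u , v) ≤?ᴾ (u′ , v′) = proj₁ (compare u v u′ v′)

    ≤ᴾ-total : ∀ i j → pt i ≤ʳ pt j ⊎ pt j ≤ʳ pt i
    ≤ᴾ-total (u , v) (u′ , v′) = proj₂ (compare u v u′ v′)

    points : List Point
    points = cartesianProduct (allFin order) (allFin order)

    ∈-points : ∀ i → i ∈ˡ points
    ∈-points (u , v) = ∈-cartesianProduct⁺ (∈-allFin u) (∈-allFin v)

    -- Counting predecessors embeds the total preorder of the finitely many sample points into `ℕ`.
    rank : Point → ℕ
    rank i = Σ[ points ] λ k → 𝟙 (k ≤?ᴾ i)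

    rank-reflects : ∀ i j → rank i ≤ rank j → pt i ≤ʳ pt j
    rank-reflects i j ri≤rj {q} with ≤ᴾ-total i j
    ... | inj₁ i≤j = i≤j
    -- Each indicator for `j` is at most the one for `i`, so `rank i ≤ rank j` makes them all equal.
    -- The indicator at `i` itself, which is 1 on one side, gives the claim.
    ... | inj₂ j≤i = 𝟙-≡ (i ≤?ᴾ i) (i ≤?ᴾ j)
      (sym (Σ-tight points smaller ri≤rj (∈-points i))) (λ q∈ → q∈) {q}
      where
      smaller : ∀ k → 𝟙 (k ≤?ᴾ j) ≤ 𝟙 (k ≤?ᴾ i)
      smaller k = 𝟙-mono (k ≤?ᴾ j) (k ≤?ᴾ i) λ k≤j {q} → ≤ʳ-trans (pt k) (pt j) (pt i) k≤j j≤i {q}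

    outgoing incoming : V → List Point
    outgoing u = map (u ,_) (filter (u ~?_) (allFin order))
    incoming v = map (_, v) (filter (_~? v) (allFin order))

    -- A real interval may be open or unbounded, so extreme sample points stand in for its
    -- endpoints. Both use the same default, which yields `left≤right`.
    leftmost rightmost : V → Point
    leftmost  u = argmin rank (u , u) (outgoing u)
    rightmost v = argmax rank (v , v) (incoming v)

    leftmost∈ : ∀ u → pt (leftmost u) ∈ᴵ u
    leftmost∈ u = argmin-all rank {P = λ i → pt i ∈ᴵ u} (pt∈₁ u u)
      (All.map⁺ {xs = filter (u ~?_) (allFin order)} (All.tabulate λ {v} _ → pt∈₁ u v))

    rightmost∈ : ∀ v → pt (rightmost v) ∈ᴵ v
    rightmost∈ v = argmax-all rank {P = λ i → pt i ∈ᴵ v} (pt∈₁ v v)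
      (All.map⁺ (All.map pt∈₂ (all-filter (_~? v) (allFin order))))

    left right : V → ℕ
    left  u = rank (leftmost u)
    right v = rank (rightmost v)

    -- The common point `(u , v)` is outgoing at `u` and incoming at `v`, so its rank lies between
    -- the two.
    ~⇒left≤right : ∀ {u v} → u ~ v → left u ≤ right v
    ~⇒left≤right {u} {v} u~v = ≤-trans
      (All.lookup (f[argmin]≤f[xs] {f = rank} (u , u) (outgoing u))
        (∈-map⁺ (u ,_) (∈-filter⁺ (u ~?_) (∈-allFin v) u~v)))
      (All.lookup (f[xs]≤f[argmax] {f = rank} (v , v) (incoming v))
        (∈-map⁺ (_, v) (∈-filter⁺ (_~? v) (∈-allFin u) u~v)))

    left≤right : ∀ v → left v ≤ right v
    left≤right v = ≤-trans (f[argmin]≤f[⊤] {f = rank} (v , v) (outgoing v))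
                           (f[⊥]≤f[argmax] {f = rank} (v , v) (incoming v))

    between : ∀ {u v} → pt (leftmost u) ≤ʳ pt (leftmost v) → left v ≤ right u → pt (leftmost v) ∈ᴵ u
    between {u} {v} lu≤lv lv≤ru = Interval.convex (I u)
      {pt (leftmost u)} {pt (leftmost v)} {pt (rightmost u)}
      lu≤lv (rank-reflects (leftmost v) (rightmost u) lv≤ru) (leftmost∈ u) (rightmost∈ u)

    -- The later of the two leftmost sample points lies in both intervals: convexity puts it in the
    -- one that starts earlier.
    meets⇒~ : ∀ {u v} → u ≢ v → left u ≤ right v → left v ≤ right u → u ~ v
    meets⇒~ {u} {v} u≢v lu≤rv lv≤ru = from (intersection u v u≢v)
      ([ (λ lu≤lv → pt (leftmost v) , between {u} {v} (λ {q} → lu≤lv {q}) lv≤ru , leftmost∈ v)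
       , (λ lv≤lu → pt (leftmost u) , leftmost∈ u , between {v} {u} (λ {q} → lv≤lu {q}) lu≤rv)
       ]′ (≤ᴾ-total (leftmost u) (leftmost v)))

    intervalModel : IntervalModel G
    intervalModel = record
      { left = left ; right = right ; left≤right = left≤right
      ; adjacent = λ u v u≢v → mk⇔ (λ u~v → ~⇒left≤right {u} {v} u~v , ~⇒left≤right {v} {u} (~-sym u~v))
                                   (uncurry (meets⇒~ {u} {v} u≢v)) }

¬¬-intervalModel : ∀ {G} → IsIntervalGraph G → ¬ ¬ IntervalModel G
¬¬-intervalModel {G} (I , intersection) = ¬¬-map intervalModel ¬¬-compare
  where open Model G I intersection

theorem11 : ∃[ C ] (0 < C ×
    ((G : Graph) → Connected G → IsIntervalGraph G →
    (r : ℕ) → 1 ≤ r →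
    (k : ℕ) → 1 ≤ k → k ≤ Graph.order G →
    pc r G k ≤ C * k ^ 2 * r))
theorem11 = 7 , s≤s z≤n , λ G _ interval r 1≤r k 1≤k _ →
  decidable-stable (pc r G k ≤? 7 * k ^ 2 * r)
    (¬¬-map (λ M → Counting.pc≤ M r 1≤r k 1≤k) (¬¬-intervalModel interval))
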